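{- Let $k\ge1$ be a fixed integer. Let $G$ be a simple undirected $k$-edge-connected graph with $n$ vertices and $O(kn)$ edges, and let $e$ be an edge of $G$. Then the procedure HandleDeletion$(e)$ (described in the context) runs in $O(k^{3/2}n^{3/2})$ time.
   Context: All graphs are finite, simple, undirected and unweighted; a graph is $k$-edge-connected if removing fewer than $k$ edges cannot disconnect it. **Flow network.** For $e=\{u,v\}$ and $G'=G\setminus\{e\}$, each undirected edge $\{x,y\}$ of $G'$ is modelled by the two arcs $(x,y)$ and $(y,x)$, each of capacity $1$. For an integral maximum $u$–$v$ flow $f$, the residual capacity of $(x,y)$ is $1-f(x,y)+f(y,x)$, and the residual graph $G_f$ consists of the arcs of positive residual capacity. **HandleDeletion$(e)$**, for $e=\{u,v\}$. Delete $e$ to obtain $G'$ and compute a maximum $u$–$v$ flow $f$ in $G'$ with Dinic's algorithm (which runs in $O(\min(n^{2/3},m^{1/2})\,m)$ time on unit-capacity networks with $n$ vertices and $m$ arcs, by Even and Tarjan). If the flow value is at least $k$, stop. If it is $k-1$, compute by BFS/DFS on $G_f$ the sets $S=\{w: w\text{ is reachable from }u\text{ in }G_f\}$ and $T=\{w: v\text{ is reachable from }w\text{ in }G_f\}$. If $|S|\ge2$ or $|T|\ge2$, choose $u'\in S$, $v'\in T$ with $\{u',v'\}\neq\{u,v\}$ and add the edge $\{u',v'\}$. If $S=\{u\}$ and $T=\{v\}$, choose $w\in V\setminus\{u,v\}$ and add the edges $\{u,w\}$ and $\{w,v\}$. The choices are otherwise arbitrary. -}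

module Defs where

open import Data.Bool.Base using (Bool; true; false; if_then_else_; not; _∧_)
open import Data.Fin.Base using (Fin)
open import Data.Fin.Properties using (_≟_; _<?_)
open import Data.Integer.Base as ℤ using (ℤ; +_; 0ℤ; 1ℤ)
import Data.Integer.Properties as ℤ
open import Data.List.Base as List using (List; []; _∷_; length; allFin; concatMap; filter)
open import Data.List.Membership.Propositional using (_∈_)
open import Data.List.Relation.Unary.All using (All)
open import Data.List.Relation.Unary.Unique.Propositional using (Unique)
open import Data.Nat.Base using (ℕ; zero; suc; _+_; _*_; _^_; _≤_; _<_)
open import Data.Nat.ListAction using (sum)
open import Data.Product.Base using (∃; _×_; _,_; uncurry)
open import Data.Sum.Base using (_⊎_)
open import Data.Unit.Base using (⊤; tt)
open import Data.Vec.Base as Vec using (Vec; lookup; _[_]≔_)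
open import Relation.Binary.Construct.Closure.ReflexiveTransitive using (Star)
open import Relation.Binary.PropositionalEquality using (_≡_; _≢_)
open import Relation.Nullary using (¬_; Dec; does; yes; no)

------------------------------------------------------------------------
-- Graphs

-- Adjacency lists.  The entry y in the list of x is the arc (x , y).
Digraph : ℕ → Set
Digraph n = Vec (List (Fin n)) n

Arc : ∀ {n} → Digraph n → Fin n → Fin n → Set
Arc N x y = y ∈ lookup N x

NoParallelArcs : ∀ {n} → Digraph n → Set
NoParallelArcs N = ∀ x → Unique (lookup N x)

arcCount : ∀ {n} → Digraph n → ℕ
arcCount N = Vec.sum (Vec.map length N)

-- A simple undirected graph stores {x , y} as the two arcs (x , y), (y , x).
-- Hence its adjacency lists are also those of the unit-capacity network
-- in which every edge is replaced by two opposite arcs.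
record Graph (n : ℕ) : Set where
  field
    adj         : Digraph n
    simple      : NoParallelArcs adj
    irreflexive : ∀ x → ¬ Arc adj x x
    symmetric   : ∀ x y → Arc adj x y → Arc adj y x

  Edge : Fin n → Fin n → Set
  Edge = Arc adj

  -- Each edge once, smaller endpoint first.
  edges : List (Fin n × Fin n)
  edges = concatMap (λ x → List.map (x ,_) (filter (x <?_) (lookup adj x))) (allFin n)

  edgeCount : ℕ
  edgeCount = length edges

open Graph public

-- The unordered pairs {x , y} and {a , b} coincide.
SameEdge : ∀ {n} → Fin n × Fin n → Fin n × Fin n → Set
SameEdge (x , y) (a , b) = (x ≡ a × y ≡ b) ⊎ (x ≡ b × y ≡ a)

EdgeAvoiding : ∀ {n} → Graph n → List (Fin n × Fin n) → Fin n → Fin n → Set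
EdgeAvoiding G F x y = Edge G x y × All (λ e → ¬ SameEdge (x , y) e) F

EdgeConnected : ∀ {n} → ℕ → Graph n → Set
EdgeConnected k G = ∀ F → All (uncurry (Edge G)) F → length F < k →
  ∀ x y → Star (EdgeAvoiding G F) x y

------------------------------------------------------------------------
-- Integral flows in unit-capacity networks

Flow : ℕ → Set
Flow n = Fin n → Fin n → ℕ

∑ : ∀ {n} → (Fin n → ℕ) → ℕ
∑ {n} g = sum (List.map g (allFin n))

record IsFlow {n} (N : Digraph n) (s t : Fin n) (f : Flow n) : Set where
  field
    capacity     : ∀ x y → f x y ≤ 1
    support      : ∀ x y → ¬ Arc N x y → f x y ≡ 0
    conservation : ∀ x → x ≢ s → x ≢ t → ∑ (λ y → f x y) ≡ ∑ (λ y → f y x)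

flowValue : ∀ {n} → Fin n → Flow n → ℤ
flowValue s f = (+ ∑ (λ y → f s y)) ℤ.- (+ ∑ (λ y → f y s))

IsMaximumFlow : ∀ {n} → Digraph n → Fin n → Fin n → Flow n → Set
IsMaximumFlow N s t f =
  IsFlow N s t f × (∀ g → IsFlow N s t g → flowValue s g ℤ.≤ flowValue s f)

residual : ∀ {n} → Flow n → Fin n → Fin n → ℤ
residual f x y = (1ℤ ℤ.- (+ f x y)) ℤ.+ (+ f y x)

------------------------------------------------------------------------
-- Time

-- Cost model: unit-cost RAM.  One unit of time pays for a bounded number of
-- word operations: arithmetic and comparison of vertices and counters, one
-- step along a list, one array access.  A `Vec` stands for an array; all
-- arrays below are used single-threadedly, so `_[_]≔_` is an update in place.
-- A `Flow` stands for one word per arc; the algorithm consults f x y and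
-- f y x only while it stands on an entry of an adjacency list joining x and y,
-- so with a link from each arc to its reverse this is a bounded number of reads.
record Timed (A : Set) : Set where
  constructor timed
  field
    result : A
    time   : ℕ

open Timed public

infixl 1 _>>=_ _>>_

return : ∀ {A} → A → Timed A
return a = timed a 0

_>>=_ : ∀ {A B} → Timed A → (A → Timed B) → Timed B
m >>= f = timed (result (f (result m))) (time m + time (f (result m)))

_>>_ : ∀ {A B} → Timed A → Timed B → Timed B
m >> p = m >>= λ _ → p

ticks : ℕ → Timed ⊤
ticks t = timed tt t

tick : Timed ⊤
tick = ticks 1

------------------------------------------------------------------------
-- The maximum-flow subroutine

-- What is used of Dinic's algorithm: it returns an integral maximum flow, and
-- (Even and Tarjan) it takes O(min(n^{2/3}, m^{1/2}) m) time.  The number q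
-- is an integer at most min(n^{2/3}, m^{1/2}) m, with the roots cleared:
-- q ≤ n^{2/3} m iff q³ ≤ n² m³, and q ≤ m^{1/2} m iff q² ≤ m³.
-- The summand n pays for initialising the vertex arrays; the cited bound leaves
-- it implicit, but literally it would be 0 for a network without arcs.
record MaxFlowAlgorithm : Set where
  field
    maxFlow : ∀ {n} → Digraph n → (s t : Fin n) → Timed (Flow n)

    maximum : ∀ {n} (N : Digraph n) (s t : Fin n) → NoParallelArcs N → s ≢ t →
      IsMaximumFlow N s t (result (maxFlow N s t))

    evenTarjan : ∃ λ c → ∀ {n} (N : Digraph n) (s t : Fin n) →
      NoParallelArcs N → s ≢ t →
      ∃ λ q → q ^ 3 ≤ n ^ 2 * arcCount N ^ 3 × q ^ 2 ≤ arcCount N ^ 3 ×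
              time (maxFlow N s t) ≤ c * (q + n)

open MaxFlowAlgorithm public

------------------------------------------------------------------------
-- Updating the adjacency lists

remove : ∀ {n} → Fin n → List (Fin n) → Timed (List (Fin n))
remove v []       = return []
remove v (y ∷ ys) = do
  tick
  zs ← remove v ys
  return (if does (y ≟ v) then zs else y ∷ zs)

occurs : ∀ {n} → Fin n → List (Fin n) → Timed Bool
occurs v []       = return false
occurs v (y ∷ ys) = do
  tick
  if does (y ≟ v) then return true else occurs v ys

deleteArc : ∀ {n} → Fin n → Fin n → Digraph n → Timed (Digraph n)
deleteArc x y N = do
  tick
  ys ← remove y (lookup N x)
  return (N [ x ]≔ ys)

insertArc : ∀ {n} → Fin n → Fin n → Digraph n → Timed (Digraph n)
insertArc x y N = do
  tick
  b ← occurs y (lookup N x)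
  return (if b then N else N [ x ]≔ (y ∷ lookup N x))

deleteEdge : ∀ {n} → Fin n → Fin n → Digraph n → Timed (Digraph n)
deleteEdge x y N = do
  N₁ ← deleteArc x y N
  deleteArc y x N₁

insertEdge : ∀ {n} → Fin n → Fin n → Digraph n → Timed (Digraph n)
insertEdge x y N = do
  N₁ ← insertArc x y N
  insertArc y x N₁

------------------------------------------------------------------------
-- Breadth-first search

record SearchState (n : ℕ) : Set where
  constructor state
  field
    marked : Vec Bool n
    found  : List (Fin n)
    next   : List (Fin n)

open SearchState public

discover : ∀ {n} → Fin n → SearchState n → SearchState n
discover y (state marked found next) =
  state (marked [ y ]≔ true) (y ∷ found) (y ∷ next)

-- `usable x y` says whether the search may step from x to its neighbour y.
module _ {n} (usable : Fin n → Fin n → Bool) (N : Digraph n) where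

  scan : Fin n → List (Fin n) → SearchState n → Timed (SearchState n)
  scan x []       s = return s
  scan x (y ∷ ys) s = do
    tick
    scan x ys (if usable x y ∧ not (lookup (marked s) y) then discover y s else s)

  sweep : List (Fin n) → SearchState n → Timed (SearchState n)
  sweep []       s = return s
  sweep (x ∷ xs) s = do
    tick
    s′ ← scan x (lookup N x) s
    sweep xs s′

  -- The first argument bounds the number of remaining levels, the second is
  -- the current level.
  levels : ℕ → List (Fin n) → SearchState n → Timed (List (Fin n))
  levels zero    xs       s = return (found s)
  levels (suc d) []       s = return (found s)
  levels (suc d) (x ∷ xs) s = do
    tick
    s′ ← sweep (x ∷ xs) (record s { next = [] })
    levels d (next s′) s′

  -- Shortest paths visit at most n vertices, so n levels exhaust the search.
  search : Fin n → Timed (List (Fin n))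
  search r = do
    ticks n
    levels n (r ∷ []) (discover r (state (Vec.replicate n false) [] []))

-- As the adjacency lists are symmetric, the arcs of G_f entering x come from
-- neighbours of x, and the second search traverses the arcs of G_f backwards.
reachableFrom reaching :
  ∀ {n} → Flow n → Digraph n → Fin n → Timed (List (Fin n))
reachableFrom f = search (λ x y → does (0ℤ ℤ.<? residual f x y))
reaching      f = search (λ x y → does (0ℤ ℤ.<? residual f y x))

------------------------------------------------------------------------
-- HandleDeletion

-- The arbitrary choices of the procedure.  A choice fails only if there is
-- nothing to choose from.
record Choices (n : ℕ) : Set where
  field
    choosePair : (u v : Fin n) (S T : List (Fin n)) →
      Dec (∃ λ p → uncurry (λ u′ v′ → u′ ∈ S × v′ ∈ T) p × ¬ SameEdge p (u , v))
    chooseVertex : (u v : Fin n) → Dec (∃ λ w → w ≢ u × w ≢ v)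

open Choices public

netOutflow : ∀ {n} → Flow n → Fin n → List (Fin n) → Timed ℤ
netOutflow f x []       = return 0ℤ
netOutflow f x (y ∷ ys) = do
  tick
  r ← netOutflow f x ys
  return (((+ f x y) ℤ.- (+ f y x)) ℤ.+ r)

twoOrMore : ∀ {A : Set} → List A → Bool
twoOrMore (_ ∷ _ ∷ _) = true
twoOrMore _           = false

module _ (dinic : MaxFlowAlgorithm) {n} (choices : Choices n) where

  -- Choosing u′ and v′ is charged as a walk along the lists S and T.
  addOneEdge : (u v : Fin n) (S T : List (Fin n)) → Digraph n → Timed (Digraph n)
  addOneEdge u v S T N with choosePair choices u v S T
  ... | yes ((u′ , v′) , _) = do
    ticks (length S + length T)
    insertEdge u′ v′ N
  ... | no _ = ticks (length S + length T) >> return N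

  -- Choosing w is charged as a walk along all vertices.  It can fail only if
  -- n = 2, in which case no edge is added.
  addTwoEdges : (u v : Fin n) → Digraph n → Timed (Digraph n)
  addTwoEdges u v N with chooseVertex choices u v
  ... | yes (w , _) = do
    ticks n
    N₁ ← insertEdge u w N
    insertEdge w v N₁
  ... | no _ = ticks n >> return N

  repair : Flow n → (u v : Fin n) → Digraph n → Timed (Digraph n)
  repair f u v N = do
    S ← reachableFrom f N u
    T ← reaching f N v
    tick
    if twoOrMore S then addOneEdge u v S T N
      else if twoOrMore T then addOneEdge u v S T N
      else addTwoEdges u v N

  -- The last branch (flow value below k - 1) does not occur when the graph is
  -- k-edge-connected.
  handleDeletion : (k : ℕ) → Digraph n → (u v : Fin n) → Timed (Digraph n)
  handleDeletion k N u v = do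
    N′ ← deleteEdge u v N
    f  ← maxFlow dinic N′ u v
    r  ← netOutflow f u (lookup N′ u)
    tick
    if does ((+ k) ℤ.≤? r) then return N′
      else if does (r ℤ.≟ ((+ k) ℤ.- 1ℤ)) then repair f u v N′
      else return N′

module Submission where

-- Deleting e leaves a network with m ≤ 2 |E(G)| = O(k n) arcs, on which Dinic's
-- algorithm takes O(m^{3/2} + n) = O(k^{3/2} n^{3/2}) time.  All other steps are
-- linear in 1 + n + m; for the two breadth-first searches this holds because the
-- cost of the pending vertices plus that of the unmarked vertices never grows.

open import Defs
open import Data.Bool.Base using (Bool; true; false; if_then_else_; not; _∧_)
open import Data.Fin.Base as Fin using (Fin; zero; suc)
import Data.Fin.Properties as Fin
import Data.Integer.Base as ℤ
import Data.Integer.Properties as ℤ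
open import Data.List.Base as List using (List; []; _∷_; _++_; length)
open import Data.List.Membership.Propositional using (_∈_; lose)
open import Data.List.Membership.Propositional.Properties
open import Data.List.Properties using (length-++; length-map)
open import Data.List.Relation.Binary.Subset.Propositional using (_⊆_)
open import Data.List.Relation.Unary.All as All using (All; []; _∷_)
open import Data.List.Relation.Unary.Any using (here; there)
import Data.List.Relation.Unary.All.Properties as All
open import Data.List.Relation.Unary.AllPairs using ([]; _∷_)
import Data.List.Relation.Unary.AllPairs.Properties as AllPairs
open import Data.List.Relation.Unary.Unique.Propositional using (Unique)
import Data.List.Relation.Unary.Unique.Propositional.Properties as Unique
open import Data.Nat.Base
open import Data.Nat.Properties
open import Data.Nat.Tactic.RingSolver using (solve-∀)
open import Data.Product.Base using (∃; _×_; _,_; proj₁; proj₂; swap)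
open import Data.Product.Properties using (,-injectiveˡ; ,-injectiveʳ)
open import Data.Sum.Base using (inj₁; inj₂)
open import Data.Vec.Base as Vec using (Vec; []; _∷_; lookup; _[_]≔_)
open import Data.Vec.Properties using (lookup∘update; lookup∘update′; lookup-replicate)
open import Function.Base using (_∘_)
open import Relation.Binary.Construct.Closure.ReflexiveTransitive using (Star; ε; _◅_; _◅◅_)
open import Relation.Binary.Definitions using (tri<; tri≈; tri>)
open import Relation.Binary.PropositionalEquality
open import Relation.Nullary using (does; yes; no; contradiction)

private variable
  A B : Set
  n : ℕ

-- `arcCount` for lists of arbitrary elements, because the tail of a
-- `Digraph (suc n)` is not a `Digraph n`.
totalLength : Vec (List A) n → ℕ
totalLength = Vec.sum ∘ Vec.map length

-- Counting arcs

-- Induction on `xs`: cutting one occurrence of `x` out of `ys` leaves `as ++ bs`, which still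
-- contains the tail, since uniqueness makes every element of the tail differ from `x`.
length-Unique-⊆ : {xs ys : List A} → Unique xs → xs ⊆ ys → length xs ≤ length ys
length-Unique-⊆ {xs = []} _ _ = z≤n
length-Unique-⊆ {xs = x ∷ xs} (x≢xs ∷ uniq) sub with ∈-∃++ (sub (here refl))
... | as , bs , refl = begin
  suc (length xs)              ≤⟨ s≤s (length-Unique-⊆ uniq sub′) ⟩
  suc (length (as ++ bs))      ≡⟨ cong suc (length-++ as) ⟩
  suc (length as + length bs)  ≡⟨ +-suc (length as) (length bs) ⟨
  length as + suc (length bs)  ≡⟨ length-++ as ⟨
  length (as ++ x ∷ bs)        ∎
  where
  open ≤-Reasoning
  sub′ : xs ⊆ as ++ bs
  sub′ z∈xs with ∈-++⁻ as (sub (there z∈xs))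
  ... | inj₁ z∈as         = ∈-++⁺ˡ z∈as
  ... | inj₂ (here refl)  = contradiction refl (All.lookup x≢xs z∈xs)
  ... | inj₂ (there z∈bs) = ∈-++⁺ʳ as z∈bs

length-concat-tabulate : (N : Vec (List B) n) (g : Fin n → List A) →
  (∀ x → length (g x) ≡ length (lookup N x)) →
  length (List.concat (List.tabulate g)) ≡ totalLength N
length-concat-tabulate []       g eq = refl
length-concat-tabulate (ys ∷ N) g eq = trans
  (length-++ (g zero))
  (cong₂ _+_ (eq zero) (length-concat-tabulate N (g ∘ suc) (eq ∘ suc)))

module _ (G : Graph n) where

  arcsFrom : Fin n → List (Fin n × Fin n)
  arcsFrom x = List.map (x ,_) (lookup (adj G) x)

  arcs : List (Fin n × Fin n)
  arcs = List.concat (List.tabulate arcsFrom)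

  length-arcs : length arcs ≡ arcCount (adj G)
  length-arcs = length-concat-tabulate (adj G) arcsFrom λ x → length-map (x ,_) (lookup (adj G) x)

  -- Arcs with a common source differ in their targets because the graph is simple; arcs from
  -- different lists differ in their sources.
  arcs-unique : Unique arcs
  arcs-unique = Unique.concat⁺
    (All.tabulate⁺ λ x → Unique.map⁺ ,-injectiveʳ (simple G x))
    (AllPairs.tabulate⁺ disjoint)
    where
    disjoint : ∀ {x y} → x ≢ y → ∀ {p} → p ∈ arcsFrom x × p ∈ arcsFrom y → _
    disjoint x≢y (p∈ , q∈) with ∈-map⁻ _ p∈ | ∈-map⁻ _ q∈
    ... | _ , _ , refl | _ , _ , eq = x≢y (,-injectiveˡ eq)

  ∈-arcs⁻ : ∀ {x y} → (x , y) ∈ arcs → Edge G x y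
  ∈-arcs⁻ p with ∈-concat⁻′ (List.tabulate arcsFrom) p
  ... | _ , p∈ , q with ∈-tabulate⁻ q
  ... | _ , refl with ∈-map⁻ _ p∈
  ... | _ , y∈ , refl = y∈

  ∈-edges⁺ : ∀ {x y} → x Fin.< y → Edge G x y → (x , y) ∈ edges G
  ∈-edges⁺ {x} {y} x<y y∈ =
    ∈-concatMap⁺ _ (lose (∈-allFin x) (∈-map⁺ _ (∈-filter⁺ (x Fin.<?_) y∈ x<y)))

  -- An arc whose source is the larger endpoint is the reverse of a listed edge; irreflexivity rules
  -- out the case of equal endpoints.
  arcs⊆edges : arcs ⊆ edges G ++ List.map swap (edges G)
  arcs⊆edges {x , y} p with Fin.<-cmp x y | ∈-arcs⁻ p
  ... | tri< x<y _ _  | a = ∈-++⁺ˡ (∈-edges⁺ x<y a)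
  ... | tri≈ _ refl _ | a = contradiction a (irreflexive G x)
  ... | tri> _ _ y<x  | a = ∈-++⁺ʳ (edges G) (∈-map⁺ swap (∈-edges⁺ y<x (symmetric G x y a)))

  arcCount≤2*edgeCount : arcCount (adj G) ≤ 2 * edgeCount G
  arcCount≤2*edgeCount = begin
    arcCount (adj G)                                  ≡⟨ length-arcs ⟨
    length arcs                                       ≤⟨ length-Unique-⊆ arcs-unique arcs⊆edges ⟩
    length (edges G ++ List.map swap (edges G))       ≡⟨ length-++ (edges G) ⟩
    edgeCount G + length (List.map swap (edges G))    ≡⟨ cong (edgeCount G +_) (length-map swap (edges G)) ⟩
    edgeCount G + edgeCount G                         ≡⟨ cong (edgeCount G +_) (+-identityʳ (edgeCount G)) ⟨
    2 * edgeCount G                                   ∎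
    where open ≤-Reasoning

-- Updates of the adjacency lists

length-lookup≤totalLength : (N : Vec (List A) n) (x : Fin n) → length (lookup N x) ≤ totalLength N
length-lookup≤totalLength (ys ∷ N) zero    = m≤m+n (length ys) (totalLength N)
length-lookup≤totalLength (ys ∷ N) (suc x) = ≤-trans (length-lookup≤totalLength N x) (m≤n+m (totalLength N) (length ys))

-- `d` is the allowed growth of a single list: 0 for a deletion, 1 for an insertion.
totalLength-update : ∀ d (N : Vec (List A) n) x {ys} → length ys ≤ d + length (lookup N x) →
  totalLength (N [ x ]≔ ys) ≤ d + totalLength N
totalLength-update d (zs ∷ N) zero    {ys} le = begin
  length ys + totalLength N          ≤⟨ +-monoˡ-≤ (totalLength N) le ⟩
  d + length zs + totalLength N      ≡⟨ +-assoc d (length zs) (totalLength N) ⟩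
  d + (length zs + totalLength N)    ∎
  where open ≤-Reasoning
totalLength-update d (zs ∷ N) (suc x) {ys} le = begin
  length zs + totalLength (N [ x ]≔ ys)  ≤⟨ +-monoʳ-≤ (length zs) (totalLength-update d N x le) ⟩
  length zs + (d + totalLength N)        ≡⟨ lemma (length zs) d (totalLength N) ⟩
  d + (length zs + totalLength N)        ∎
  where
  open ≤-Reasoning
  lemma : ∀ a b c → a + (b + c) ≡ b + (a + c)
  lemma = solve-∀

remove-time : (v : Fin n) (ys : List (Fin n)) → time (remove v ys) ≡ length ys
remove-time v []       = refl
remove-time v (y ∷ ys) = cong suc (trans (+-identityʳ _) (remove-time v ys))

remove-length : (v : Fin n) (ys : List (Fin n)) → length (result (remove v ys)) ≤ length ys
remove-length v []       = z≤n
remove-length v (y ∷ ys) with y Fin.≟ v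
... | yes _ = m≤n⇒m≤1+n (remove-length v ys)
... | no  _ = s≤s (remove-length v ys)

remove-All : {P : Fin n → Set} (v : Fin n) {ys : List (Fin n)} →
  All P ys → All P (result (remove v ys))
remove-All v []                 = []
remove-All v {y ∷ ys} (py ∷ ps) with y Fin.≟ v
... | yes _ = remove-All v ps
... | no  _ = py ∷ remove-All v ps

remove-Unique : (v : Fin n) {ys : List (Fin n)} → Unique ys → Unique (result (remove v ys))
remove-Unique v []                   = []
remove-Unique v {y ∷ ys} (y∉ys ∷ ps) with y Fin.≟ v
... | yes _ = remove-Unique v ps
... | no  _ = remove-All v y∉ys ∷ remove-Unique v ps

occurs-time : (v : Fin n) (ys : List (Fin n)) → time (occurs v ys) ≤ length ys
occurs-time v []       = z≤n
occurs-time v (y ∷ ys) with y Fin.≟ v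
... | yes _ = s≤s z≤n
... | no  _ = s≤s (occurs-time v ys)

module _ (x y : Fin n) (N : Digraph n) where

  open ≤-Reasoning

  deleteArc-time : time (deleteArc x y N) ≤ 1 + arcCount N
  deleteArc-time = s≤s (begin
    time (remove y (lookup N x)) + 0  ≡⟨ +-identityʳ _ ⟩
    time (remove y (lookup N x))      ≡⟨ remove-time y (lookup N x) ⟩
    length (lookup N x)               ≤⟨ length-lookup≤totalLength N x ⟩
    arcCount N                        ∎)

  deleteArc-arcCount : arcCount (result (deleteArc x y N)) ≤ arcCount N
  deleteArc-arcCount = totalLength-update 0 N x (remove-length y (lookup N x))

  deleteArc-noParallelArcs : NoParallelArcs N → NoParallelArcs (result (deleteArc x y N))
  deleteArc-noParallelArcs simp z with z Fin.≟ x
  ... | yes refl = subst Unique (sym (lookup∘update z N _)) (remove-Unique y (simp z))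
  ... | no  z≢x  = subst Unique (sym (lookup∘update′ z≢x N _)) (simp z)

  insertArc-time : time (insertArc x y N) ≤ 1 + arcCount N
  insertArc-time = s≤s (begin
    time (occurs y (lookup N x)) + 0  ≡⟨ +-identityʳ _ ⟩
    time (occurs y (lookup N x))      ≤⟨ occurs-time y (lookup N x) ⟩
    length (lookup N x)               ≤⟨ length-lookup≤totalLength N x ⟩
    arcCount N                        ∎)

  insertArc-arcCount : arcCount (result (insertArc x y N)) ≤ 1 + arcCount N
  insertArc-arcCount with result (occurs y (lookup N x))
  ... | true  = n≤1+n _
  ... | false = totalLength-update 1 N x ≤-refl

module _ (x y : Fin n) (N : Digraph n) where

  private
    N₋ = result (deleteArc x y N)
    N₊ = result (insertArc x y N)

  deleteEdge-time : time (deleteEdge x y N) ≤ (1 + arcCount N) + (1 + arcCount N)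
  deleteEdge-time = +-mono-≤ (deleteArc-time x y N)
    (≤-trans (deleteArc-time y x N₋) (s≤s (deleteArc-arcCount x y N)))

  deleteEdge-arcCount : arcCount (result (deleteEdge x y N)) ≤ arcCount N
  deleteEdge-arcCount = ≤-trans (deleteArc-arcCount y x N₋) (deleteArc-arcCount x y N)

  -- The bound of Even and Tarjan is assumed only for networks without parallel arcs, and Dinic's
  -- algorithm runs on the network after the deletion.
  deleteEdge-noParallelArcs : NoParallelArcs N → NoParallelArcs (result (deleteEdge x y N))
  deleteEdge-noParallelArcs = deleteArc-noParallelArcs y x N₋ ∘ deleteArc-noParallelArcs x y N

  -- The second insertion may scan a list that the first has lengthened by one arc, whence 2 in
  -- place of 1.
  insertEdge-time : time (insertEdge x y N) ≤ (1 + arcCount N) + (2 + arcCount N)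
  insertEdge-time = +-mono-≤ (insertArc-time x y N)
    (≤-trans (insertArc-time y x N₊) (s≤s (insertArc-arcCount x y N)))

  insertEdge-arcCount : arcCount (result (insertEdge x y N)) ≤ 2 + arcCount N
  insertEdge-arcCount = ≤-trans (insertArc-arcCount y x N₊) (s≤s (insertArc-arcCount x y N))

-- Breadth-first search

module _ (N : Digraph n) where

  -- The budget of a vertex: one unit for its visit in `sweep`, one per entry of its list, and one
  -- spare unit towards the tick of its level.
  cost : Fin n → ℕ
  cost x = 2 + length (lookup N x)

  costs : List (Fin n) → ℕ
  costs []       = 0
  costs (x ∷ xs) = cost x + costs xs

  length≤costs : ∀ xs → length xs ≤ costs xs
  length≤costs []       = z≤n
  length≤costs (x ∷ xs) = +-mono-≤ (s≤s z≤n) (length≤costs xs)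

-- The budget set aside for vertices not yet discovered, with the same weight per vertex as `cost`.
unmarkedCost : Vec (List A) n → Vec Bool n → ℕ
unmarkedCost []       []           = 0
unmarkedCost (ys ∷ N) (true  ∷ bs) = unmarkedCost N bs
unmarkedCost (ys ∷ N) (false ∷ bs) = 2 + length ys + unmarkedCost N bs

unmarkedCost-none : (N : Vec (List A) n) →
  unmarkedCost N (Vec.replicate n false) ≡ 2 * n + totalLength N
unmarkedCost-none []               = refl
unmarkedCost-none {n = suc n} (ys ∷ N) rewrite unmarkedCost-none N =
  lemma (length ys) n (totalLength N)
  where
  lemma : ∀ a n m → 2 + a + (2 * n + m) ≡ 2 * suc n + (a + m)
  lemma = solve-∀

-- Marking releases exactly the budget of `x`; the sum form avoids truncated subtraction.
unmarkedCost-mark : (N : Vec (List A) n) (bs : Vec Bool n) (x : Fin n) → lookup bs x ≡ false →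
  2 + length (lookup N x) + unmarkedCost N (bs [ x ]≔ true) ≡ unmarkedCost N bs
unmarkedCost-mark (ys ∷ N) (false ∷ bs) zero    _  = refl
unmarkedCost-mark (ys ∷ N) (true  ∷ bs) (suc x) eq = unmarkedCost-mark N bs x eq
unmarkedCost-mark (ys ∷ N) (false ∷ bs) (suc x) eq = trans
  (lemma (length (lookup N x)) (length ys) (unmarkedCost N (bs [ x ]≔ true)))
  (cong (2 + length ys +_) (unmarkedCost-mark N bs x eq))
  where
  lemma : ∀ a b c → 2 + a + (2 + b + c) ≡ 2 + b + (2 + a + c)
  lemma = solve-∀

-- All that the accounting has to know about a scan or a sweep: the state changes by discoveries,
-- each of a vertex unmarked at that moment.
data Discovery {n} : SearchState n → SearchState n → Set where
  discovery : ∀ {s} y → lookup (marked s) y ≡ false → Discovery s (discover y s)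

module _ (N : Digraph n) where

  -- Taken with `next` it bounds the time of the search, with `found` the length of the output.
  potential : (SearchState n → List (Fin n)) → SearchState n → ℕ
  potential pending s = costs N (pending s) + unmarkedCost N (marked s)

  -- The cost of `y` moves from the unmarked part to the list, so the total is conserved.
  potential-discover : ∀ xs s y → lookup (marked s) y ≡ false →
    costs N (y ∷ xs) + unmarkedCost N (marked (discover y s)) ≡ costs N xs + unmarkedCost N (marked s)
  potential-discover xs s y eq = trans
    (lemma (cost N y) (costs N xs) (unmarkedCost N (marked s [ y ]≔ true)))
    (cong (costs N xs +_) (unmarkedCost-mark N (marked s) y eq))
    where
    lemma : ∀ a b c → a + b + c ≡ b + (a + c)
    lemma = solve-∀

  potential-found : ∀ {s t} → Star Discovery s t → potential found t ≡ potential found s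
  potential-found ε                           = refl
  potential-found (discovery {s} y eq ◅ rest) =
    trans (potential-found rest) (potential-discover (found s) s y eq)

  potential-next : ∀ {s t} → Star Discovery s t → potential next t ≡ potential next s
  potential-next ε                           = refl
  potential-next (discovery {s} y eq ◅ rest) =
    trans (potential-next rest) (potential-discover (next s) s y eq)

-- Time and output size of the search

module _ (usable : Fin n → Fin n → Bool) (N : Digraph n) where

  open ≤-Reasoning

  scan-discoveries : ∀ x ys s → Star Discovery s (result (scan usable N x ys s))
  scan-discoveries x []       s = ε
  scan-discoveries x (y ∷ ys) s with usable x y | lookup (marked s) y in eq
  ... | false | _     = scan-discoveries x ys s
  ... | true  | true  = scan-discoveries x ys s
  ... | true  | false = discovery y eq ◅ scan-discoveries x ys (discover y s)

  scan-time : ∀ x ys s → time (scan usable N x ys s) ≡ length ys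
  scan-time x []       s = refl
  scan-time x (y ∷ ys) s = cong suc (scan-time x ys _)

  sweep-discoveries : ∀ xs s → Star Discovery s (result (sweep usable N xs s))
  sweep-discoveries []       s = ε
  sweep-discoveries (x ∷ xs) s =
    scan-discoveries x (lookup N x) s ◅◅ sweep-discoveries xs _

  -- The term `length xs` collects the spare units of the vertices, which remain available to the
  -- caller.
  sweep-time : ∀ xs s → length xs + time (sweep usable N xs s) ≡ costs N xs
  sweep-time []       s = refl
  sweep-time (x ∷ xs) s = begin-equality
    suc (length xs) + suc (time (scan usable N x (lookup N x) s) + time rest)
      ≡⟨ cong (λ t → suc (length xs) + suc (t + time rest)) (scan-time x (lookup N x) s) ⟩
    suc (length xs) + suc (length (lookup N x) + time rest)
      ≡⟨ lemma (length xs) (length (lookup N x)) (time rest) ⟩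
    cost N x + (length xs + time rest)
      ≡⟨ cong (cost N x +_) (sweep-time xs _) ⟩
    cost N x + costs N xs ∎
    where
    rest = sweep usable N xs (result (scan usable N x (lookup N x) s))
    lemma : ∀ a b c → suc a + suc (b + c) ≡ 2 + b + (a + c)
    lemma = solve-∀

  -- A level spends the budget of its own vertices; the budget of those it discovers passes from the
  -- unmarked part to the next level, where the induction hypothesis spends it.
  levels-time : ∀ d xs s → time (levels usable N d xs s) ≤ costs N xs + unmarkedCost N (marked s)
  levels-time zero    xs         s = z≤n
  levels-time (suc d) []         s = z≤n
  levels-time (suc d) xs@(_ ∷ _) s = begin
    suc (time (sweep usable N xs s₀) + time (levels usable N d (next s′) s′))
      -- A nonempty level has at least one spare unit, which pays for its tick.
      ≤⟨ +-mono-≤ (≤-trans (+-monoˡ-≤ _ (s≤s z≤n)) (≤-reflexive (sweep-time xs s₀)))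
                  (levels-time d (next s′) s′) ⟩
    costs N xs + potential N next s′
      -- As `next` is empty in `s₀`, the potential there is the unmarked cost alone.
      ≡⟨ cong (costs N xs +_) (potential-next N (sweep-discoveries xs s₀)) ⟩
    costs N xs + unmarkedCost N (marked s) ∎
    where
    s₀ = record s { next = [] }
    s′ = result (sweep usable N xs s₀)

  -- Every found vertex costs at least 1, so the conserved potential also bounds the size of the
  -- output.
  levels-length : ∀ d xs s → length (result (levels usable N d xs s)) ≤ potential N found s
  levels-length zero    xs         s = ≤-trans (length≤costs N (found s)) (m≤m+n _ _)
  levels-length (suc d) []         s = ≤-trans (length≤costs N (found s)) (m≤m+n _ _)
  levels-length (suc d) xs@(_ ∷ _) s = begin
    length (result (levels usable N d (next s′) s′))  ≤⟨ levels-length d (next s′) s′ ⟩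
    potential N found s′                              ≡⟨ potential-found N (sweep-discoveries xs s₀) ⟩
    potential N found s₀                              ∎
    where
    s₀ = record s { next = [] }
    s′ = result (sweep usable N xs s₀)

  potential-initial : ∀ r →
    costs N (r ∷ []) + unmarkedCost N (Vec.replicate n false [ r ]≔ true) ≡ 2 * n + arcCount N
  potential-initial r = trans
    (potential-discover N [] (state (Vec.replicate n false) [] []) r (lookup-replicate r false))
    (unmarkedCost-none N)

  search-time : ∀ r → time (search usable N r) ≤ n + (2 * n + arcCount N)
  search-time r = +-monoʳ-≤ n (≤-trans (levels-time n (r ∷ []) _) (≤-reflexive (potential-initial r)))

  search-length : ∀ r → length (result (search usable N r)) ≤ 2 * n + arcCount N
  search-length r = ≤-trans (levels-length n (r ∷ []) _) (≤-reflexive (potential-initial r))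

-- HandleDeletion

netOutflow-time : (f : Flow n) (x : Fin n) (ys : List (Fin n)) →
  time (netOutflow f x ys) ≡ length ys
netOutflow-time f x []       = refl
netOutflow-time f x (y ∷ ys) = cong suc (trans (+-identityʳ _) (netOutflow-time f x ys))

if-time-≤ : ∀ (b : Bool) {p q : Timed A} {t} → time p ≤ t → time q ≤ t →
  time (if b then p else q) ≤ t
if-time-≤ true  p≤t q≤t = p≤t
if-time-≤ false p≤t q≤t = q≤t

module _ (dinic : MaxFlowAlgorithm) (choices : Choices n) where

  open ≤-Reasoning

  addOneEdge-time : ∀ u v S T N →
    time (addOneEdge dinic choices u v S T N) ≤ (length S + length T) + (3 + 2 * arcCount N)
  addOneEdge-time u v S T N with choosePair choices u v S T
  ... | yes ((u′ , v′) , _) = +-monoʳ-≤ (length S + length T)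
    (≤-trans (insertEdge-time u′ v′ N) (≤-reflexive (lemma (arcCount N))))
    where
    lemma : ∀ m → (1 + m) + (2 + m) ≡ 3 + 2 * m
    lemma = solve-∀
  ... | no _ = +-monoʳ-≤ (length S + length T) z≤n

  addTwoEdges-time : ∀ u v N →
    time (addTwoEdges dinic choices u v N) ≤ n + (10 + 4 * arcCount N)
  addTwoEdges-time u v N with chooseVertex choices u v
  ... | no _        = +-monoʳ-≤ n z≤n
  ... | yes (w , _) = +-monoʳ-≤ n (begin
    time (insertEdge u w N) + time (insertEdge w v N₁)
      ≤⟨ +-mono-≤ (insertEdge-time u w N) (insertEdge-time w v N₁) ⟩
    (1 + m) + (2 + m) + ((1 + arcCount N₁) + (2 + arcCount N₁))
      ≤⟨ +-monoʳ-≤ ((1 + m) + (2 + m)) (+-mono-≤ (+-monoʳ-≤ 1 m₁≤) (+-monoʳ-≤ 2 m₁≤)) ⟩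
    (1 + m) + (2 + m) + ((1 + (2 + m)) + (2 + (2 + m)))
      ≡⟨ lemma m ⟩
    10 + 4 * m ∎)
    where
    m   = arcCount N
    N₁  = result (insertEdge u w N)
    m₁≤ = insertEdge-arcCount u w N
    lemma : ∀ m → (1 + m) + (2 + m) + ((1 + (2 + m)) + (2 + (2 + m))) ≡ 10 + 4 * m
    lemma = solve-∀

  repair-time : ∀ f u v N →
    time (repair dinic choices f u v N) ≤ 14 * (1 + n + arcCount N)
  repair-time f u v N = begin
    time S + (time T + (1 + time modification))
      ≤⟨ +-mono-≤ (search-time _ N u) (+-mono-≤ (search-time _ N v) (s≤s modification-time)) ⟩
    (n + b) + ((n + b) + (1 + ((b + b + (3 + 2 * m)) + (n + (10 + 4 * m)))))
      -- The sum equals 14 + 11 n + 10 m; the added slack turns it into a multiple of 1 + n + m.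
      ≤⟨ m≤m+n _ (3 * n + 4 * m) ⟩
    (n + b) + ((n + b) + (1 + ((b + b + (3 + 2 * m)) + (n + (10 + 4 * m))))) + (3 * n + 4 * m)
      ≡⟨ lemma n m ⟩
    14 * (1 + n + m) ∎
    where
    m = arcCount N
    b = 2 * n + m
    S = reachableFrom f N u
    T = reaching f N v
    addOne       = addOneEdge dinic choices u v (result S) (result T) N
    modification = if twoOrMore (result S) then addOne
      else if twoOrMore (result T) then addOne
      else addTwoEdges dinic choices u v N
    -- Adding the bounds of the two kinds of repair gives one bound valid in every branch.
    addOne-time : time addOne ≤ (b + b + (3 + 2 * m)) + (n + (10 + 4 * m))
    addOne-time = ≤-trans (addOneEdge-time u v (result S) (result T) N) (≤-trans
      (+-monoˡ-≤ _ (+-mono-≤ (search-length _ N u) (search-length _ N v))) (m≤m+n _ _))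
    modification-time : time modification ≤ (b + b + (3 + 2 * m)) + (n + (10 + 4 * m))
    modification-time = if-time-≤ (twoOrMore (result S)) addOne-time
      (if-time-≤ (twoOrMore (result T)) addOne-time
        (≤-trans (addTwoEdges-time u v N) (m≤n+m _ (b + b + (3 + 2 * m)))))
    lemma : ∀ n m → (n + (2 * n + m)) + ((n + (2 * n + m)) + (1 + (((2 * n + m) + (2 * n + m) + (3 + 2 * m)) + (n + (10 + 4 * m))))) + (3 * n + 4 * m)
      ≡ 14 * (1 + n + m)
    lemma = solve-∀

  -- The time `t` of the flow computation stays a parameter, since it alone may be superlinear. Of
  -- the factor 17, `repair` takes 14; the deletion, the flow value and the final tick take 3.
  handleDeletion-time : ∀ k N u v t →
    let N′ = result (deleteEdge u v N) in
    time (maxFlow dinic N′ u v) ≤ t →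
    time (handleDeletion dinic choices k N u v) ≤ t + 17 * (1 + n + arcCount N)
  handleDeletion-time k N u v t flow-time = begin
    time (deleteEdge u v N) + (time flow + (time net + (1 + time final)))
      ≤⟨ +-mono-≤ (deleteEdge-time u v N) (+-mono-≤ flow-time (+-mono-≤ net-time (s≤s final-time))) ⟩
    (1 + m) + (1 + m) + (t + (m + (1 + 14 * (1 + n + m))))
      ≤⟨ m≤m+n _ (3 * n) ⟩
    (1 + m) + (1 + m) + (t + (m + (1 + 14 * (1 + n + m)))) + 3 * n
      ≡⟨ lemma t n m ⟩
    t + 17 * (1 + n + m) ∎
    where
    m    = arcCount N
    N′   = result (deleteEdge u v N)
    m′≤m = deleteEdge-arcCount u v N
    flow = maxFlow dinic N′ u v
    f    = result flow
    net  = netOutflow f u (lookup N′ u)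
    r    = result net
    final = if does ((ℤ.+ k) ℤ.≤? r) then return N′
      else if does (r ℤ.≟ ((ℤ.+ k) ℤ.- ℤ.1ℤ)) then repair dinic choices f u v N′
      else return N′
    net-time : time net ≤ m
    net-time = ≤-trans (≤-reflexive (netOutflow-time f u (lookup N′ u)))
      (≤-trans (length-lookup≤totalLength N′ u) m′≤m)
    final-time : time final ≤ 14 * (1 + n + m)
    final-time = if-time-≤ (does ((ℤ.+ k) ℤ.≤? r)) z≤n
      (if-time-≤ (does (r ℤ.≟ ((ℤ.+ k) ℤ.- ℤ.1ℤ)))
        (≤-trans (repair-time f u v N′) (*-monoʳ-≤ 14 (+-monoʳ-≤ (1 + n) m′≤m)))
        z≤n)
    lemma : ∀ t n m → (1 + m) + (1 + m) + (t + (m + (1 + 14 * (1 + n + m)))) + 3 * n ≡ t + 17 * (1 + n + m)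
    lemma = solve-∀

-- Bounds a ≤ α √X, with the root cleared

^-distribʳ-* : ∀ o m n → (m * n) ^ o ≡ m ^ o * n ^ o
^-distribʳ-* zero    m n = refl
^-distribʳ-* (suc o) m n = trans (cong (m * n *_) (^-distribʳ-* o m n)) (lemma m n (m ^ o) (n ^ o))
  where
  lemma : ∀ a b c d → a * b * (c * d) ≡ a * c * (b * d)
  lemma = solve-∀

module _ {X : ℕ} where

  open ≤-Reasoning

  -- Multiplying the hypotheses compares the squares of both sides; strict monotonicity of squaring
  -- then removes the squares by contraposition.
  √-cross : ∀ {a b α β} → a ^ 2 ≤ α ^ 2 * X → b ^ 2 ≤ β ^ 2 * X → a * b ≤ α * β * X
  √-cross {a} {b} {α} {β} a≤ b≤ = ≮⇒≥ λ lt → <⇒≱ (^-monoˡ-< 2 lt) (begin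
    (a * b) ^ 2                     ≡⟨ ^-distribʳ-* 2 a b ⟩
    a ^ 2 * b ^ 2                   ≤⟨ *-mono-≤ a≤ b≤ ⟩
    (α ^ 2 * X) * (β ^ 2 * X)       ≡⟨ lemma α β X ⟩
    (α * β * X) ^ 2                 ∎)
    where
    -- The solver does not know _^_ on ℕ, so squares are written in unfolded form.
    lemma : ∀ a b x → ((a * (a * 1)) * x) * ((b * (b * 1)) * x) ≡ (a * b * x) * ((a * b * x) * 1)
    lemma = solve-∀

  -- Bounds by multiples of √X add up: in the expanded square, `√-cross` takes care of the mixed
  -- term.
  √-+ : ∀ {a b α β} → a ^ 2 ≤ α ^ 2 * X → b ^ 2 ≤ β ^ 2 * X → (a + b) ^ 2 ≤ (α + β) ^ 2 * X
  √-+ {a} {b} {α} {β} a≤ b≤ = begin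
    (a + b) ^ 2                                       ≡⟨ lemma₁ a b ⟩
    a ^ 2 + b ^ 2 + 2 * (a * b)                       ≤⟨ +-mono-≤ (+-mono-≤ a≤ b≤) (*-monoʳ-≤ 2 (√-cross {a} {b} {α} {β} a≤ b≤)) ⟩
    α ^ 2 * X + β ^ 2 * X + 2 * (α * β * X)           ≡⟨ lemma₂ α β X ⟩
    (α + β) ^ 2 * X                                   ∎
    where
    lemma₁ : ∀ a b → (a + b) * ((a + b) * 1) ≡ a * (a * 1) + b * (b * 1) + 2 * (a * b)
    lemma₁ = solve-∀
    lemma₂ : ∀ a b x → a * (a * 1) * x + b * (b * 1) * x + 2 * (a * b * x) ≡ (a + b) * ((a + b) * 1) * x
    lemma₂ = solve-∀

  √-* : ∀ c {a α} → a ^ 2 ≤ α ^ 2 * X → (c * a) ^ 2 ≤ (c * α) ^ 2 * X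
  √-* c {a} {α} a≤ = begin
    (c * a) ^ 2            ≡⟨ ^-distribʳ-* 2 c a ⟩
    c ^ 2 * a ^ 2          ≤⟨ *-monoʳ-≤ (c ^ 2) a≤ ⟩
    c ^ 2 * (α ^ 2 * X)    ≡⟨ *-assoc (c ^ 2) (α ^ 2) X ⟨
    c ^ 2 * α ^ 2 * X      ≡⟨ cong (_* X) (^-distribʳ-* 2 c α) ⟨
    (c * α) ^ 2 * X        ∎

-- Substituting m = O(k n) and fixing the constant

mainTheorem4 : (dinic : MaxFlowAlgorithm) (C : ℕ) →
    ∃ λ A → ∀ (k n : ℕ) (G : Graph n) (u v : Fin n) (choices : Choices n) →
    1 ≤ k → EdgeConnected k G → edgeCount G ≤ C * (k * n) → Edge G u v →
    time (handleDeletion dinic choices k (adj G) u v) ^ 2 ≤ A ^ 2 * (k ^ 3 * n ^ 3)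
-- The first summand pays for the term `q` of the flow time, the second for everything linear: `c`
-- for initialising the flow computation, 17 for the remaining steps.
mainTheorem4 dinic C = c * D ^ 2 + (c + 17) * (2 + D) , bound
  where
  open ≤-Reasoning
  c = proj₁ (evenTarjan dinic)
  -- The summand 1 makes `D` positive, so that its powers increase with the exponent.
  D = 1 + 2 * C

  module _ (k n : ℕ) (G : Graph n) (u v : Fin n) (choices : Choices n)
    (1≤k : 1 ≤ k) (sparse : edgeCount G ≤ C * (k * n)) (uv : Edge G u v) where

    N  = adj G
    m  = arcCount N
    N′ = result (deleteEdge u v N)
    X  = k ^ 3 * n ^ 3
    L  = 1 + n + m

    1≤n : 1 ≤ n
    1≤n = ≤-trans (s≤s z≤n) (Fin.toℕ<n u)

    m≤D*kn : m ≤ D * (k * n)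
    m≤D*kn = begin
      m                      ≤⟨ arcCount≤2*edgeCount G ⟩
      2 * edgeCount G        ≤⟨ *-monoʳ-≤ 2 sparse ⟩
      2 * (C * (k * n))      ≡⟨ *-assoc 2 C (k * n) ⟨
      2 * C * (k * n)        ≤⟨ *-monoˡ-≤ (k * n) (n≤1+n (2 * C)) ⟩
      D * (k * n)            ∎

    L≤[2+D]*kn : L ≤ (2 + D) * (k * n)
    L≤[2+D]*kn = begin
      1 + n + m                            ≤⟨ +-mono-≤ (+-mono-≤ (*-mono-≤ 1≤k 1≤n) (m≤n*m n k ⦃ >-nonZero 1≤k ⦄)) m≤D*kn ⟩
      k * n + k * n + D * (k * n)          ≡⟨ lemma (k * n) D ⟩
      (2 + D) * (k * n)                    ∎
      where
      lemma : ∀ x d → x + x + d * x ≡ (2 + d) * x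
      lemma = solve-∀

    -- Linear terms are O(k n), and k n ≥ 1 allows raising the exponent of k n from 2 to 3.
    L-bound : L ^ 2 ≤ (2 + D) ^ 2 * X
    L-bound = begin
      L ^ 2                          ≤⟨ ^-monoˡ-≤ 2 L≤[2+D]*kn ⟩
      ((2 + D) * (k * n)) ^ 2        ≡⟨ ^-distribʳ-* 2 (2 + D) (k * n) ⟩
      (2 + D) ^ 2 * (k * n) ^ 2      ≤⟨ *-monoʳ-≤ ((2 + D) ^ 2) (^-monoʳ-≤ (k * n) ⦃ >-nonZero (*-mono-≤ 1≤k 1≤n) ⦄ (n≤1+n 2)) ⟩
      (2 + D) ^ 2 * (k * n) ^ 3      ≡⟨ cong ((2 + D) ^ 2 *_) (^-distribʳ-* 3 k n) ⟩
      (2 + D) ^ 2 * X                ∎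

    q-bound : ∀ {q} → q ^ 2 ≤ arcCount N′ ^ 3 → q ^ 2 ≤ (D ^ 2) ^ 2 * X
    q-bound {q} q≤ = begin
      q ^ 2                    ≤⟨ q≤ ⟩
      arcCount N′ ^ 3          ≤⟨ ^-monoˡ-≤ 3 (≤-trans (deleteEdge-arcCount u v N) m≤D*kn) ⟩
      (D * (k * n)) ^ 3        ≡⟨ ^-distribʳ-* 3 D (k * n) ⟩
      D ^ 3 * (k * n) ^ 3      ≡⟨ cong (D ^ 3 *_) (^-distribʳ-* 3 k n) ⟩
      -- Passing to the fourth power makes the coefficient a perfect square, the form that `√-*` and
      -- `√-+` expect.
      D ^ 3 * X                ≤⟨ *-monoˡ-≤ X (^-monoʳ-≤ D (n≤1+n 3)) ⟩
      D ^ 4 * X                ≡⟨ cong (_* X) (^-*-assoc D 2 2) ⟨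
      (D ^ 2) ^ 2 * X          ∎

    u≢v : u ≢ v
    u≢v refl = irreflexive G u uv

    result-bound : time (handleDeletion dinic choices k N u v) ^ 2 ≤ (c * D ^ 2 + (c + 17) * (2 + D)) ^ 2 * X
    result-bound with proj₂ (evenTarjan dinic) N′ u v (deleteEdge-noParallelArcs u v N (simple G)) u≢v
    ... | q , _ , q≤ , flow-time = begin
      time (handleDeletion dinic choices k N u v) ^ 2
        ≤⟨ ^-monoˡ-≤ 2 (handleDeletion-time dinic choices k N u v _ flow-time) ⟩
      (c * (q + n) + 17 * L) ^ 2
        -- Since n ≤ `L`, the initialisation cost joins the linear term.
        ≤⟨ ^-monoˡ-≤ 2 (+-monoˡ-≤ (17 * L) (*-monoʳ-≤ c (+-monoʳ-≤ q (≤-trans (n≤1+n n) (m≤m+n (1 + n) m))))) ⟩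
      (c * (q + L) + 17 * L) ^ 2
        ≡⟨ cong (_^ 2) (lemma c q L) ⟩
      (c * q + (c + 17) * L) ^ 2
        ≤⟨ √-+ {a = c * q} {α = c * D ^ 2} {β = (c + 17) * (2 + D)} (√-* c {q} {D ^ 2} (q-bound {q} q≤)) (√-* (c + 17) {L} {2 + D} L-bound) ⟩
      (c * D ^ 2 + (c + 17) * (2 + D)) ^ 2 * X ∎
      where
      lemma : ∀ c q l → c * (q + l) + 17 * l ≡ c * q + (c + 17) * l
      lemma = solve-∀

  bound = λ k n G u v choices 1≤k _ → result-bound k n G u v choices 1≤k
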